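{- Let $n\ge 3$ be odd. The subgroup $\mathbf{O}_E$ of the $n\times n\times n$ Rubik's Cube group $\mathbf{G}$ consisting of the elements that leave every cubie in its position and fix every sticker not lying on a single edge cubie (so that they only change single edge orientations) is isomorphic to $\mathbb{Z}_2^{11}$.
   Context: The $n\times n\times n$ Rubik's Cube has faces U, D, F, B, R, L, each an $n\times n$ grid of facelets carrying stickers ($6n^2$ in total). For $1\le k\le\lfloor n/2\rfloor$, $F_k,B_k,R_k,L_k,U_k,D_k$ denote clockwise (seen from the named face) $90^\circ$ rotations of the $k$-th $n\times n\times 1$ slice counted from the named face. $\mathbf{G}$ is the subgroup of the symmetric group on the facelets generated by the facelet permutations induced by these moves. Along each of the 12 edges of the big cube lie edge cubies (two stickers) at positions $2,\dots,n-1$; for odd $n$ the one at position $(n+1)/2$ is a single edge (12 in total), which can be flipped in place between 2 orientations (elements of $\mathbb{Z}_2$). -}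

module Defs where

open import Data.Nat using (ℕ; zero; suc; _+_; _*_; _∸_; _≟_)
open import Data.Fin using (Fin; toℕ; opposite)
open import Data.Bool using (Bool; true; false; _xor_)
open import Data.Vec using (Vec; zipWith)
open import Data.List using (List; []; _∷_; _++_)
open import Data.Product using (Σ; _×_; _,_; proj₁; proj₂; ∃)
open import Data.Sum using (_⊎_)
open import Relation.Nullary using (¬_; yes; no)
open import Relation.Binary.PropositionalEquality using (_≡_)

-- The cube occupies the grid {0,…,n-1}³ of cubie positions (coordinates x,y,z).
data Axis : Set where
  X Y Z : Axis

-- A direction (outward normal of a sticker): an axis and a sign (true = +, false = −).
Dir : Set
Dir = Axis × Bool

Pos : ℕ → Set
Pos n = Fin n × Fin n × Fin n

-- A point: a cubie position together with a normal direction.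
-- Facelets are the points whose normal points out of the big cube (see IsFacelet).
Point : ℕ → Set
Point n = Pos n × Dir

coord : ∀ {n} → Axis → Pos n → Fin n
coord X (x , y , z) = x
coord Y (x , y , z) = y
coord Z (x , y , z) = z

IsExtremeAt : ℕ → Bool → ℕ → Set
IsExtremeAt n true  i = i ≡ n ∸ 1
IsExtremeAt n false i = i ≡ 0

IsFacelet : ∀ {n} → Point n → Set
IsFacelet {n} (p , (a , s)) = IsExtremeAt n s (toℕ (coord a p))

Facelet : ℕ → Set
Facelet n = Σ (Point n) IsFacelet

-- 90° rotation of the whole space about an axis (same handedness for each axis),
-- acting on positions and on directions.
rotPos : ∀ {n} → Axis → Pos n → Pos n
rotPos X (x , y , z) = (x , z , opposite y)
rotPos Y (x , y , z) = (opposite z , y , x)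
rotPos Z (x , y , z) = (y , opposite x , z)

rotDir : Axis → Dir → Dir
rotDir X (X , s) = (X , s)
rotDir X (Y , true) = (Z , false)
rotDir X (Y , false) = (Z , true)
rotDir X (Z , s) = (Y , s)
rotDir Y (Y , s) = (Y , s)
rotDir Y (Z , true) = (X , false)
rotDir Y (Z , false) = (X , true)
rotDir Y (X , s) = (Z , s)
rotDir Z (Z , s) = (Z , s)
rotDir Z (X , true) = (Y , false)
rotDir Z (X , false) = (Y , true)
rotDir Z (Y , s) = (X , s)

IsMiddle : ℕ → ℕ → Set
IsMiddle n i = 2 * i + 1 ≡ n

-- A generator: the 90° turn of the layer {coord axis = layer} about axis.
-- For odd n the layers k-th from some face, 1 ≤ k ≤ ⌊n/2⌋, are exactly the
-- non-middle layers.
record Gen (n : ℕ) : Set where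
  constructor gen
  field
    axis      : Axis
    layer     : Fin n
    notMiddle : ¬ IsMiddle n (toℕ layer)

open Gen public

move : ∀ {n} → Gen n → Point n → Point n
move (gen a c _) (p , d) with toℕ (coord a p) ≟ toℕ c
... | yes _ = (rotPos a p , rotDir a d)
... | no  _ = (p , d)

-- elements of G are represented by words in the generators
-- (act (g₁ ∷ … ∷ gₖ ∷ []) = move gₖ ∘ … ∘ move g₁, i.e. apply g₁ first)
act : ∀ {n} → List (Gen n) → Point n → Point n
act []      q = q
act (g ∷ w) q = act w (move g q)

_≈G_ : ∀ {n} → List (Gen n) → List (Gen n) → Set
_≈G_ {n} v w = (f : Facelet n) → act v (proj₁ f) ≡ act w (proj₁ f)

IsExtreme : ℕ → ℕ → Set
IsExtreme n i = IsExtremeAt n false i ⊎ IsExtremeAt n true i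

IsSingleEdge : ∀ {n} → Pos n → Set
IsSingleEdge {n} (x , y , z) =
    (IsExtreme n (toℕ x) × IsExtreme n (toℕ y) × IsMiddle n (toℕ z))
  ⊎ (IsExtreme n (toℕ x) × IsMiddle n (toℕ y) × IsExtreme n (toℕ z))
  ⊎ (IsMiddle n (toℕ x) × IsExtreme n (toℕ y) × IsExtreme n (toℕ z))

InOE : ∀ {n} → List (Gen n) → Set
InOE {n} w =
    ((f : Facelet n) → proj₁ (act w (proj₁ f)) ≡ proj₁ (proj₁ f))
  × ((f : Facelet n) → ¬ IsSingleEdge (proj₁ (proj₁ f)) → act w (proj₁ f) ≡ proj₁ f)

OE : ℕ → Set
OE n = Σ (List (Gen n)) InOE

Z2^ : ℕ → Set
Z2^ k = Vec Bool k

_⊕_ : ∀ {k} → Z2^ k → Z2^ k → Z2^ k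
_⊕_ = zipWith _xor_

-- a group isomorphism O_E ≅ ℤ₂^k: a well-defined map that is a homomorphism
-- (the product of a and b in G is represented by the word a ++ b, up to ≈G),
-- injective and surjective
IsIsoOE : (n k : ℕ) → (OE n → Z2^ k) → Set
IsIsoOE n k φ =
    ((a b : OE n) → proj₁ a ≈G proj₁ b → φ a ≡ φ b)
  × ((a b c : OE n) → proj₁ c ≈G (proj₁ a ++ proj₁ b) → φ c ≡ (φ a ⊕ φ b))
  × ((a b : OE n) → φ a ≡ φ b → proj₁ a ≈G proj₁ b)
  × ((v : Z2^ k) → ∃ λ a → φ a ≡ v)

{-# OPTIONS --safe #-}
module Submission where

-- Inner layers do not meet the single edges, so on their 24 stickers a word acts as
-- on the 3 × 3 × 3 cube. The two stickers of each edge can be numbered so that a face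
-- turn exchanges the numbers on exactly the four edges which it moves; hence an even
-- number of edges is flipped by every word fixing their positions, and the flips of
-- eleven of them determine the twelfth.
--
-- Conversely, the turn T of all non-middle layers about an axis replaces, up to a
-- rotation of the whole cube, the missing turn of the middle layer. A word in face
-- turns and such T treats all other inner layers alike, so its effect is computed
-- once and for all on facelets with symbolic coordinates. One such word flips exactly
-- two single edges, and eleven of its conjugates flip each edge together with the last.

open import Defs
open import Data.Bool using (Bool; true; false; not; _xor_; if_then_else_)
open import Data.Bool.Properties using (not-involutive; xor-identityʳ; xor-assoc; xor-comm) renaming (_≟_ to _≟ᵇ_)
open import Data.Bool.Solver using (module xor-∧-Solver)
open import Data.Empty using (⊥-elim)
open import Data.Fin using (Fin; zero; suc; toℕ; fromℕ; fromℕ<; opposite; #_)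
open import Data.Fin.Properties using (toℕ-injective; toℕ-fromℕ; toℕ-fromℕ<; opposite-prop; opposite-involutive; all?)
open import Data.List using (List; []; _∷_; _++_; concatMap; replicate; map; reverse; allFin)
open import Data.List.Properties using (map-++)
open import Data.List.Membership.Propositional using (_∈_)
open import Data.List.Membership.Propositional.Properties using (∈-allFin)
open import Data.List.Relation.Unary.All as All using (All; []; _∷_)
open import Data.List.Relation.Unary.Any using (here; there)
open import Data.List.Relation.Unary.AllPairs using ([]; _∷_)
open import Data.List.Relation.Unary.Unique.Propositional using (Unique)
open import Data.List.Relation.Unary.Unique.Propositional.Properties using (allFin⁺)
open import Data.Nat using (ℕ; zero; suc; _+_; _*_; _∸_; _≤_; _%_; _/_; z≤n; s≤s; _≟_)
open import Data.Nat.DivMod using (m≡m%n+[m/n]*n)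
open import Data.Nat.Properties
open import Data.Product using (Σ; ∃; _×_; _,_; proj₁; proj₂)
open import Data.Product.Properties using (≡-dec)
open import Data.Sum using (inj₁; inj₂)
open import Data.Vec as Vec using (Vec; []; _∷_; lookup; _[_]≔_)
open import Data.Vec.Properties as Vecₚ using ()
open import Function using (_∘_)
open import Relation.Binary using (DecidableEquality)
open import Relation.Binary.PropositionalEquality
open import Relation.Nullary using (¬_; Dec; yes; no; does)
open import Relation.Nullary.Decidable using (map′; _×-dec_; _→-dec_; from-yes)

-- Symbolic coordinates, layers and moves

data Kind : Set where
  ext   : Bool → Kind
  mid   : Kind
  other : Kind

-- var true a stands for the unknown a-coordinate of the facelet being followed,
-- var false a for its mirror image.
data Sym : Set where
  ext : Bool → Sym
  mid : Sym
  var : Bool → Axis → Sym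

kind : Sym → Kind
kind (ext s)   = ext s
kind mid       = mid
kind (var _ _) = other

mirrorKind : Kind → Kind
mirrorKind (ext s) = ext (not s)
mirrorKind mid     = mid
mirrorKind other   = other

mirror : Sym → Sym
mirror (ext s)   = ext (not s)
mirror mid       = mid
mirror (var s a) = var (not s) a

kind-mirror : ∀ c → kind (mirror c) ≡ mirrorKind (kind c)
kind-mirror (ext s)   = refl
kind-mirror mid       = refl
kind-mirror (var s a) = refl

SymPos : Set
SymPos = Sym × Sym × Sym

SymPoint : Set
SymPoint = SymPos × Dir

symCoord : Axis → SymPos → Sym
symCoord X (x , y , z) = x
symCoord Y (x , y , z) = y
symCoord Z (x , y , z) = z

symRot : Axis → SymPos → SymPos
symRot X (x , y , z) = (x , z , mirror y)
symRot Y (x , y , z) = (mirror z , y , x)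
symRot Z (x , y , z) = (y , mirror x , z)

-- Symbolic coordinates do not tell the values of kind `other` apart, so no individual inner layer
-- can be named. `inner` covers all inner layers except the middle one, and `nonMid` adds the two
-- outer ones.
data Layer : Set where
  outer        : Bool → Layer
  inner nonMid : Layer

inLayer : Layer → Kind → Bool
inLayer (outer s) (ext t) = does (s ≟ᵇ t)
inLayer inner     other   = true
inLayer nonMid    (ext _) = true
inLayer nonMid    other   = true
inLayer _         _       = false

SymMove : Set
SymMove = Axis × Layer

turnIf : Bool → Axis → SymPoint → SymPoint
turnIf true  a (p , d) = (symRot a p , rotDir a d)
turnIf false a q       = q

symMove : SymMove → SymPoint → SymPoint
symMove (a , L) q = turnIf (inLayer L (kind (symCoord a (proj₁ q)))) a q

symAct : List SymMove → SymPoint → SymPoint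
symAct []      q = q
symAct (g ∷ w) q = symAct w (symMove g q)

-- The twelve single edges and their stickers

next prev : Axis → Axis
next X = Y
next Y = Z
next Z = X
prev X = Z
prev Y = X
prev Z = Y

-- (m , s , t) is the edge parallel to m lying on the faces (next m , s) and (prev m , t).
-- Its stickers are numbered false (on the first face) and true (on the second).
Edge : Set
Edge = Axis × Bool × Bool

Sticker : Set
Sticker = Edge × Bool

edgePos : Edge → SymPos
edgePos (X , s , t) = (mid , ext s , ext t)
edgePos (Y , s , t) = (ext t , mid , ext s)
edgePos (Z , s , t) = (ext s , ext t , mid)

stickerDir : Sticker → Dir
stickerDir ((m , s , t) , false) = (next m , s)
stickerDir ((m , s , t) , true)  = (prev m , t)

stickerPoint : Sticker → SymPoint
stickerPoint (e , b) = (edgePos e , stickerDir (e , b))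

data Relative (a : Axis) : Axis → Set where
  same   : Relative a a
  isNext : Relative a (next a)
  isPrev : Relative a (prev a)

relative : ∀ a m → Relative a m
relative X X = same
relative X Y = isNext
relative X Z = isPrev
relative Y X = isPrev
relative Y Y = same
relative Y Z = isNext
relative Z X = isNext
relative Z Y = isPrev
relative Z Z = same

-- The numbering of the stickers is such that a turn renumbers the stickers of
-- exactly those edges which it moves: the Boolean component records this.
turnEdge : SymMove → Edge → Edge × Bool
turnEdge (a , L) (m , s , t) with relative a m
... | same   = (m , s , t) , false
... | isNext = if inLayer L (ext t) then ((prev a , t , s) , true) else ((m , s , t) , false)
... | isPrev = if inLayer L (ext s) then ((next a , not t , s) , true) else ((m , s , t) , false)

turnSticker : SymMove → Sticker → Sticker
turnSticker g (e , b) = (proj₁ (turnEdge g e) , proj₂ (turnEdge g e) xor b)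

-- Deciding statements about symbolic points

_≟ᵃ_ : DecidableEquality Axis
X ≟ᵃ X = yes refl
X ≟ᵃ Y = no λ ()
X ≟ᵃ Z = no λ ()
Y ≟ᵃ X = no λ ()
Y ≟ᵃ Y = yes refl
Y ≟ᵃ Z = no λ ()
Z ≟ᵃ X = no λ ()
Z ≟ᵃ Y = no λ ()
Z ≟ᵃ Z = yes refl

_≟ˢ_ : DecidableEquality Sym
ext s   ≟ˢ ext t   = map′ (cong ext) (λ { refl → refl }) (s ≟ᵇ t)
ext _   ≟ˢ mid     = no λ ()
ext _   ≟ˢ var _ _ = no λ ()
mid     ≟ˢ ext _   = no λ ()
mid     ≟ˢ mid     = yes refl
mid     ≟ˢ var _ _ = no λ ()
var _ _ ≟ˢ ext _   = no λ ()
var _ _ ≟ˢ mid     = no λ ()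
var s a ≟ˢ var t b = map′ (λ { (refl , refl) → refl }) (λ { refl → refl , refl }) (s ≟ᵇ t ×-dec a ≟ᵃ b)

_≟ᵏ_ : DecidableEquality Kind
ext s ≟ᵏ ext t = map′ (cong ext) (λ { refl → refl }) (s ≟ᵇ t)
ext _ ≟ᵏ mid   = no λ ()
ext _ ≟ᵏ other = no λ ()
mid   ≟ᵏ ext _ = no λ ()
mid   ≟ᵏ mid   = yes refl
mid   ≟ᵏ other = no λ ()
other ≟ᵏ ext _ = no λ ()
other ≟ᵏ mid   = no λ ()
other ≟ᵏ other = yes refl

_≟ᵖ_ : DecidableEquality SymPoint
_≟ᵖ_ = ≡-dec (≡-dec _≟ˢ_ (≡-dec _≟ˢ_ _≟ˢ_)) (≡-dec _≟ᵃ_ _≟ᵇ_)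

allBool? : {P : Bool → Set} → (∀ b → Dec (P b)) → Dec (∀ b → P b)
allBool? P? = map′ (λ { (p , q) false → p ; (p , q) true → q }) (λ h → h false , h true)
                   (P? false ×-dec P? true)

allAxis? : {P : Axis → Set} → (∀ a → Dec (P a)) → Dec (∀ a → P a)
allAxis? P? = map′ (λ { (p , q , r) X → p ; (p , q , r) Y → q ; (p , q , r) Z → r })
                   (λ h → h X , h Y , h Z)
                   (P? X ×-dec P? Y ×-dec P? Z)

allKind? : {P : Kind → Set} → (∀ K → Dec (P K)) → Dec (∀ K → P K)
allKind? P? = map′ (λ { (p , q , r) (ext s) → p s ; (p , q , r) mid → q ; (p , q , r) other → r })
                   (λ h → h ∘ ext , h mid , h other)
                   (allBool? (P? ∘ ext) ×-dec P? mid ×-dec P? other)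

allLayer? : {P : Layer → Set} → (∀ L → Dec (P L)) → Dec (∀ L → P L)
allLayer? P? = map′ (λ { (p , q , r) (outer s) → p s ; (p , q , r) inner → q ; (p , q , r) nonMid → r })
                    (λ h → h ∘ outer , h inner , h nonMid)
                    (allBool? (P? ∘ outer) ×-dec P? inner ×-dec P? nonMid)

-- Edge stickers have no variable coordinate, so this justification of `turnEdge` is a finite check
-- by evaluation.
symMove-sticker : ∀ a L m s t b →
  symMove (a , L) (stickerPoint ((m , s , t) , b)) ≡ stickerPoint (turnSticker (a , L) ((m , s , t) , b))
symMove-sticker = from-yes
  (allAxis? λ a → allLayer? λ L → allAxis? λ m → allBool? λ s → allBool? λ t → allBool? λ b →
    symMove (a , L) (stickerPoint ((m , s , t) , b)) ≟ᵖ stickerPoint (turnSticker (a , L) ((m , s , t) , b)))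

turnStickers : List SymMove → Sticker → Sticker
turnStickers []      s = s
turnStickers (g ∷ w) s = turnStickers w (turnSticker g s)

symAct-sticker : ∀ w s → symAct w (stickerPoint s) ≡ stickerPoint (turnStickers w s)
symAct-sticker []            s = refl
symAct-sticker ((a , L) ∷ w) s@((m , u , t) , b) =
  trans (cong (symAct w) (symMove-sticker a L m u t b)) (symAct-sticker w (turnSticker (a , L) s))

-- Words flipping two edges

_^^_ : SymMove → ℕ → List SymMove
g ^^ k = replicate k g

-- Every letter is a quarter turn, hence of order four, and its cube is its inverse.
inverse : List SymMove → List SymMove
inverse = concatMap (_^^ 3) ∘ reverse

-- T inverts the middle turn M up to rotating the cube, and in the rotating frame P Q is
-- M U⁻¹ M U⁻¹ M U² M⁻¹ U⁻¹ M⁻¹ U⁻¹ M⁻¹ U². This flips two edges, but also reverses the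
-- strips of centres in the middle layer on two faces. The remaining factor is this word
-- with M inverted, conjugated by M⁻¹: it reverses the same strips and shares one edge.
twoFlip : List SymMove
twoFlip = P ++ Q ++ T ^^ 1 ++ Q ++ P ++ T ^^ 3
  where
  T = (X , nonMid)
  P = T ^^ 3 ++ (Y , outer false) ^^ 1 ++ T ^^ 3 ++ (Z , outer false) ^^ 1 ++ T ^^ 3 ++ (Y , outer true) ^^ 2
  Q = T ^^ 1 ++ (Z , outer false) ^^ 1 ++ T ^^ 1 ++ (Y , outer false) ^^ 1 ++ T ^^ 1 ++ (Z , outer true) ^^ 2

edges : Vec Edge 11
edges = (X , false , false) ∷ (X , false , true) ∷ (X , true , false) ∷ (X , true , true)
      ∷ (Y , false , false) ∷ (Y , false , true) ∷ (Y , true , false) ∷ (Y , true , true)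
      ∷ (Z , false , false) ∷ (Z , false , true) ∷ (Z , true , false) ∷ []

lastEdge : Edge
lastEdge = (Z , true , true)

-- `twoFlip` flips the opposite edges `(X , false , true)` and `(X , true , false)`. Each conjugator
-- carries these two, in some order, to the corresponding entry of `edges` and to `lastEdge`.
conjugators : Vec (List SymMove) 11
conjugators = (F ^^ 1 ++ B ^^ 2)
            ∷ (F ^^ 1)
            ∷ (B ^^ 3 ++ R ^^ 2)
            ∷ (F ^^ 1 ++ U ^^ 2)
            ∷ (T ^^ 1 ++ L ^^ 3)
            ∷ (F ^^ 1 ++ B ^^ 2 ++ D ^^ 3)
            ∷ (F ^^ 1 ++ U ^^ 1)
            ∷ (F ^^ 1 ++ U ^^ 3)
            ∷ (T ^^ 1)
            ∷ (T ^^ 1 ++ L ^^ 2)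
            ∷ (F ^^ 1 ++ B ^^ 3)
            ∷ []
  where
  R = (X , outer true)
  L = (X , outer false)
  F = (Y , outer true)
  B = (Y , outer false)
  U = (Z , outer true)
  D = (Z , outer false)
  T = (Y , nonMid)

flipWord : Fin 11 → List SymMove
flipWord i = inverse (lookup conjugators i) ++ twoFlip ++ lookup conjugators i

unit : ∀ {k} → Fin k → Vec Bool k
unit {k} i = Vec.replicate k false [ i ]≔ true

turnStickers-flipWord : ∀ i m s t → proj₁ (turnStickers (flipWord i) ((m , s , t) , false)) ≡ (m , s , t)
turnStickers-flipWord = from-yes
  (all? λ i → allAxis? λ m → allBool? λ s → allBool? λ t →
    ≡-dec _≟ᵃ_ (≡-dec _≟ᵇ_ _≟ᵇ_) (proj₁ (turnStickers (flipWord i) ((m , s , t) , false))) (m , s , t))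

flips-flipWord : ∀ i → Vec.map (λ e → proj₂ (turnStickers (flipWord i) (e , false))) edges ≡ unit i
flips-flipWord = from-yes
  (all? λ i → Vecₚ.≡-dec _≟ᵇ_ (Vec.map (λ e → proj₂ (turnStickers (flipWord i) (e , false))) edges) (unit i))

symbol : Axis → Kind → Sym
symbol a (ext s) = ext s
symbol a mid     = mid
symbol a other   = var true a

Kinds : Set
Kinds = Kind × Kind × Kind

kindAt : Axis → Kinds → Kind
kindAt X (K , _ , _) = K
kindAt Y (_ , K , _) = K
kindAt Z (_ , _ , K) = K

symbols : Kinds → SymPos
symbols (K₁ , K₂ , K₃) = (symbol X K₁ , symbol Y K₂ , symbol Z K₃)

isEdge : Kinds → Bool
isEdge (ext _ , ext _ , mid) = true
isEdge (ext _ , mid , ext _) = true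
isEdge (mid , ext _ , ext _) = true
isEdge _                     = false

-- One finite check serves cubes of every size: a coordinate of kind `other` is followed as an
-- unknown, and equality of symbols gives equality for all its values. The cases include corners,
-- centres and the remaining edge cubies.
symAct-flipWord : ∀ i K₁ K₂ K₃ a s → kindAt a (K₁ , K₂ , K₃) ≡ ext s → isEdge (K₁ , K₂ , K₃) ≡ false →
  symAct (flipWord i) (symbols (K₁ , K₂ , K₃) , (a , s)) ≡ (symbols (K₁ , K₂ , K₃) , (a , s))
symAct-flipWord = from-yes
  (all? λ i → allKind? λ K₁ → allKind? λ K₂ → allKind? λ K₃ → allAxis? λ a → allBool? λ s →
    (kindAt a (K₁ , K₂ , K₃) ≟ᵏ ext s) →-dec (isEdge (K₁ , K₂ , K₃) ≟ᵇ false) →-dec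
    (symAct (flipWord i) (symbols (K₁ , K₂ , K₃) , (a , s)) ≟ᵖ (symbols (K₁ , K₂ , K₃) , (a , s))))

-- Parity of the edge flips

parity : (Edge → Bool) → Bool
parity f = Vec.foldr _ _xor_ (f lastEdge) (Vec.map f edges)

edgeIndex : Edge → Fin 12
edgeIndex (X , false , false) = # 0
edgeIndex (X , false , true)  = # 1
edgeIndex (X , true  , false) = # 2
edgeIndex (X , true  , true)  = # 3
edgeIndex (Y , false , false) = # 4
edgeIndex (Y , false , true)  = # 5
edgeIndex (Y , true  , false) = # 6
edgeIndex (Y , true  , true)  = # 7
edgeIndex (Z , false , false) = # 8
edgeIndex (Z , false , true)  = # 9
edgeIndex (Z , true  , false) = # 10
edgeIndex (Z , true  , true)  = # 11

values : (Edge → Bool) → Vec Bool 12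
values f = Vec.map f edges Vec.∷ʳ f lastEdge

lookup-values : ∀ f e → lookup (values f) (edgeIndex e) ≡ f e
lookup-values f (X , false , false) = refl
lookup-values f (X , false , true)  = refl
lookup-values f (X , true  , false) = refl
lookup-values f (X , true  , true)  = refl
lookup-values f (Y , false , false) = refl
lookup-values f (Y , false , true)  = refl
lookup-values f (Y , true  , false) = refl
lookup-values f (Y , true  , true)  = refl
lookup-values f (Z , false , false) = refl
lookup-values f (Z , false , true)  = refl
lookup-values f (Z , true  , false) = refl
lookup-values f (Z , true  , true)  = refl

module _ where
  open xor-∧-Solver renaming (var to atom)

  parityPoly : (Edge → Polynomial 12) → Polynomial 12
  parityPoly f = Vec.foldr _ _:+_ (f lastEdge) (Vec.map f edges)

  turnedPoly : SymMove → Polynomial 12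
  turnedPoly g = parityPoly λ e → con (proj₂ (turnEdge g e)) :+ atom (edgeIndex (proj₁ (turnEdge g e)))

  startPoly : Polynomial 12
  startPoly = parityPoly (atom ∘ edgeIndex)

  -- A turn permutes the twelve edges and renumbers none (`inner`), four (`outer`) or eight
  -- (`nonMid`) of them, so the renumbering bits cancel modulo 2. For each symbolic move this is an
  -- identity of linear polynomials in the twelve values of `f`, settled by normalisation.
  parity-turnEdge : ∀ g (f : Edge → Bool) →
    parity (λ e → proj₂ (turnEdge g e) xor f (proj₁ (turnEdge g e))) ≡ parity f
  parity-turnEdge (X , outer false) f = prove (values f) (turnedPoly (X , outer false)) startPoly refl
  parity-turnEdge (X , outer true)  f = prove (values f) (turnedPoly (X , outer true)) startPoly refl
  parity-turnEdge (X , inner)       f = prove (values f) (turnedPoly (X , inner)) startPoly refl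
  parity-turnEdge (X , nonMid)      f = prove (values f) (turnedPoly (X , nonMid)) startPoly refl
  parity-turnEdge (Y , outer false) f = prove (values f) (turnedPoly (Y , outer false)) startPoly refl
  parity-turnEdge (Y , outer true)  f = prove (values f) (turnedPoly (Y , outer true)) startPoly refl
  parity-turnEdge (Y , inner)       f = prove (values f) (turnedPoly (Y , inner)) startPoly refl
  parity-turnEdge (Y , nonMid)      f = prove (values f) (turnedPoly (Y , nonMid)) startPoly refl
  parity-turnEdge (Z , outer false) f = prove (values f) (turnedPoly (Z , outer false)) startPoly refl
  parity-turnEdge (Z , outer true)  f = prove (values f) (turnedPoly (Z , outer true)) startPoly refl
  parity-turnEdge (Z , inner)       f = prove (values f) (turnedPoly (Z , inner)) startPoly refl
  parity-turnEdge (Z , nonMid)      f = prove (values f) (turnedPoly (Z , nonMid)) startPoly refl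

parity-cong : ∀ {f g : Edge → Bool} → (∀ e → f e ≡ g e) → parity f ≡ parity g
parity-cong f≗g = cong₂ (Vec.foldr _ _xor_) (f≗g lastEdge) (Vecₚ.map-cong f≗g edges)

flips : List SymMove → Edge → Bool
flips w e = proj₂ (turnStickers w (e , false))

-- A turn sends both stickers of an edge to the same edge and only adds a bit to their numbers.
-- Hence one bit per edge describes the effect of a word on both stickers.
turnStickers-xor : ∀ w e b →
  turnStickers w (e , b) ≡ (proj₁ (turnStickers w (e , false)) , b xor flips w e)
turnStickers-xor []      e b = cong (e ,_) (sym (xor-identityʳ b))
turnStickers-xor (g ∷ w) e b with turnEdge g e
... | e′ , c rewrite turnStickers-xor w e′ (c xor b) | turnStickers-xor w e′ (c xor false) =
  cong (_ ,_) (trans (cong (_xor flips w e′) (trans (xor-comm c b) (cong (b xor_) (sym (xor-identityʳ c)))))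
                     (xor-assoc b (c xor false) (flips w e′)))

-- The invariant that costs one of the twelve bits. After the first turn the flips of the remaining
-- word are read at the moved edges, which is the sum treated by `parity-turnEdge`. The induction
-- runs over all words, as the tail of a word need not restore the edges.
parity-flips : ∀ w → parity (flips w) ≡ false
parity-flips []      = refl
parity-flips (g ∷ w) = trans (parity-cong step) (trans (parity-turnEdge g (flips w)) (parity-flips w))
  where
  step : ∀ e → flips (g ∷ w) e ≡ proj₂ (turnEdge g e) xor flips w (proj₁ (turnEdge g e))
  step e = trans (cong proj₂ (turnStickers-xor w (proj₁ (turnEdge g e)) (proj₂ (turnEdge g e) xor false)))
                 (cong (_xor flips w (proj₁ (turnEdge g e))) (xor-identityʳ (proj₂ (turnEdge g e))))

turnStickers-++ : ∀ v w s → turnStickers (v ++ w) s ≡ turnStickers w (turnStickers v s)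
turnStickers-++ []      w s = refl
turnStickers-++ (g ∷ v) w s = turnStickers-++ v w (turnSticker g s)

xor-cancelˡ : ∀ x {y z} → x xor y ≡ x xor z → y ≡ z
xor-cancelˡ true  {y} {z} eq = trans (sym (not-involutive y)) (trans (cong not eq) (not-involutive z))
xor-cancelˡ false eq = eq

foldr-xor-injective : ∀ {k} (v : Vec Bool k) {y z} → Vec.foldr _ _xor_ y v ≡ Vec.foldr _ _xor_ z v → y ≡ z
foldr-xor-injective []      eq = eq
foldr-xor-injective (x ∷ v) eq = foldr-xor-injective v (xor-cancelˡ x eq)

-- `parity` starts its fold with the value at `lastEdge`, so cancelling the eleven common values
-- leaves an equation between the two values there.
parity-determines : ∀ f g → parity f ≡ parity g → Vec.map f edges ≡ Vec.map g edges → ∀ e → f e ≡ g e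
parity-determines f g eq eqs e = begin
  f e                              ≡⟨ lookup-values f e ⟨
  lookup (values f) (edgeIndex e)  ≡⟨ cong (λ v → lookup v (edgeIndex e)) (cong₂ Vec._∷ʳ_ eqs last≡) ⟩
  lookup (values g) (edgeIndex e)  ≡⟨ lookup-values g e ⟩
  g e                              ∎
  where
  open ≡-Reasoning
  last≡ : f lastEdge ≡ g lastEdge
  last≡ = foldr-xor-injective (Vec.map g edges)
            (trans (cong (Vec.foldr _ _xor_ (f lastEdge)) (sym eqs)) eq)

-- The units generate the group: a vector with head `true` is `unit zero` plus one with head
-- `false`. This reduces surjectivity to the eleven units.
unit-induction : ∀ {k} (P : Vec Bool k → Set) → P (Vec.replicate k false) → (∀ i → P (unit i)) →
                 (∀ u v → P u → P v → P (u ⊕ v)) → ∀ v → P v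
unit-induction P base units closed [] = base
unit-induction {suc k} P base units closed (b ∷ v) = addHead b
  where
  falseHead : ∀ v → P (false ∷ v)
  falseHead = unit-induction (P ∘ (false ∷_)) base (units ∘ suc) (λ u v → closed (false ∷ u) (false ∷ v))

  addHead : ∀ b → P (b ∷ v)
  addHead false = falseHead v
  addHead true  = subst (λ u → P (true ∷ u)) (Vecₚ.zipWith-identityˡ (λ _ → refl) v)
                        (closed _ _ (units zero) (falseHead v))

-- The cube with 2m + 1 layers, m = k + 1

module Cube (k : ℕ) where

  m n : ℕ
  m = suc k
  n = suc (m * 2)

  middle⇒m : ∀ {i} → IsMiddle n i → i ≡ m
  middle⇒m {i} eq = *-cancelˡ-≡ i m 2 (trans (suc-injective (trans (+-comm 1 (2 * i)) eq)) (*-comm m 2))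

  m⇒middle : ∀ {i} → i ≡ m → IsMiddle n i
  m⇒middle refl = trans (+-comm (2 * m) 1) (cong suc (*-comm 2 m))

  m≢m*2 : m ≢ m * 2
  m≢m*2 = <⇒≢ (m<m*n m 2 (s≤s (s≤s z≤n)))

  KindOf : Kind → Fin n → Set
  KindOf (ext s) x = IsExtremeAt n s (toℕ x)
  KindOf mid     x = toℕ x ≡ m
  KindOf other   x = toℕ x ≢ 0 × toℕ x ≢ m × toℕ x ≢ m * 2

  kindOf : ∀ x → ∃ λ K → KindOf K x
  kindOf x with toℕ x ≟ 0 | toℕ x ≟ m | toℕ x ≟ m * 2
  ... | yes p | _     | _     = ext false , p
  ... | no _  | yes p | _     = mid , p
  ... | no _  | no _  | yes p = ext true , p
  ... | no p  | no q  | no r  = other , p , q , r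

  -- The indices `0`, `m` and `m * 2` are pairwise distinct because `m` is a successor, and `other`
  -- excludes all three.
  kind-unique : ∀ K K′ {x} → KindOf K x → KindOf K′ x → K ≡ K′
  kind-unique (ext false) (ext false) p q = refl
  kind-unique (ext false) (ext true)  p q with () ← trans (sym p) q
  kind-unique (ext true)  (ext false) p q with () ← trans (sym p) q
  kind-unique (ext true)  (ext true)  p q = refl
  kind-unique (ext false) mid         p q with () ← trans (sym p) q
  kind-unique (ext true)  mid         p q = ⊥-elim (m≢m*2 (trans (sym q) p))
  kind-unique (ext false) other       p (q , _) = ⊥-elim (q p)
  kind-unique (ext true)  other       p (_ , _ , q) = ⊥-elim (q p)
  kind-unique mid         (ext false) p q with () ← trans (sym p) q
  kind-unique mid         (ext true)  p q = ⊥-elim (m≢m*2 (trans (sym p) q))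
  kind-unique mid         mid         p q = refl
  kind-unique mid         other       p (_ , q , _) = ⊥-elim (q p)
  kind-unique other       (ext false) (p , _) q = ⊥-elim (p q)
  kind-unique other       (ext true)  (_ , _ , p) q = ⊥-elim (p q)
  kind-unique other       mid         (_ , p , _) q = ⊥-elim (p q)
  kind-unique other       other       p q = refl

  toℕ-opposite : ∀ {i} (x : Fin n) → toℕ x ≡ i → toℕ (opposite x) ≡ m * 2 ∸ i
  toℕ-opposite x eq = trans (opposite-prop x) (cong (m * 2 ∸_) eq)

  m*2∸m≡m : m * 2 ∸ m ≡ m
  m*2∸m≡m = trans (cong (_∸ m) (trans (*-comm m 2) (cong (m +_) (+-identityʳ m)))) (m+n∸m≡n m m)

  opposite-special : ∀ K {x} → K ≢ other → KindOf K x → KindOf (mirrorKind K) (opposite x)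
  opposite-special (ext false) {x} _  p = toℕ-opposite x p
  opposite-special (ext true)  {x} _  p = trans (toℕ-opposite x p) (n∸n≡0 (m * 2))
  opposite-special mid         {x} _  p = trans (toℕ-opposite x p) m*2∸m≡m
  opposite-special other           K≢ _ = ⊥-elim (K≢ refl)

  -- In the case `other`, if `opposite x` were extreme or middle, reflecting it back by
  -- `opposite-involutive` would make `x` extreme or middle too.
  opposite-kind : ∀ K {x} → KindOf K x → KindOf (mirrorKind K) (opposite x)
  opposite-kind (ext s) = opposite-special (ext s) λ ()
  opposite-kind mid     = opposite-special mid λ ()
  opposite-kind other {x} p =
    avoid (ext false) (λ ()) (λ ()) , avoid mid (λ ()) (λ ()) , avoid (ext true) (λ ()) (λ ())
    where
    avoid : ∀ K → K ≢ other → mirrorKind K ≢ other → ¬ KindOf K (opposite x)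
    avoid K K≢ mK≢ q = mK≢ (kind-unique (mirrorKind K) other
      (subst (KindOf (mirrorKind K)) (opposite-involutive x) (opposite-special K K≢ q)) p)

  extreme : Bool → Fin n
  extreme false = zero
  extreme true  = fromℕ (m * 2)

  middle : Fin n
  middle = fromℕ< {m} (s≤s (m≤m*n m 2))

  extreme-kind : ∀ s → KindOf (ext s) (extreme s)
  extreme-kind false = refl
  extreme-kind true  = toℕ-fromℕ (m * 2)

  middle-kind : KindOf mid middle
  middle-kind = toℕ-fromℕ< (s≤s (m≤m*n m 2))

  kind-injective : ∀ K {x y} → K ≢ other → KindOf K x → KindOf K y → toℕ x ≡ toℕ y
  kind-injective (ext false) _ p q = trans p (sym q)
  kind-injective (ext true)  _ p q = trans p (sym q)
  kind-injective mid         _ p q = trans p (sym q)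
  kind-injective other       K≢ _ _ = ⊥-elim (K≢ refl)

  -- Evaluation of symbolic points

  module Valuation (v : Axis → Fin n) where

    value : Sym → Fin n
    value (ext s)       = extreme s
    value mid           = middle
    value (var true a)  = v a
    value (var false a) = opposite (v a)

    value-mirror : ∀ c → value (mirror c) ≡ opposite (value c)
    value-mirror (ext s) = toℕ-injective
      (kind-injective (ext (not s)) (λ ()) (extreme-kind (not s)) (opposite-kind (ext s) {extreme s} (extreme-kind s)))
    value-mirror mid = toℕ-injective
      (kind-injective mid (λ ()) middle-kind (opposite-kind mid {middle} middle-kind))
    value-mirror (var true a)  = refl
    value-mirror (var false a) = sym (opposite-involutive (v a))

    evalPos : SymPos → Pos n
    evalPos (x , y , z) = (value x , value y , value z)

    eval : SymPoint → Point n
    eval (p , d) = (evalPos p , d)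

    coord-evalPos : ∀ a p → coord a (evalPos p) ≡ value (symCoord a p)
    coord-evalPos X p = refl
    coord-evalPos Y p = refl
    coord-evalPos Z p = refl

    evalPos-rot : ∀ a p → evalPos (symRot a p) ≡ rotPos a (evalPos p)
    evalPos-rot X (x , y , z) = cong (λ c → value x , value z , c) (value-mirror y)
    evalPos-rot Y (x , y , z) = cong (λ c → c , value y , value x) (value-mirror z)
    evalPos-rot Z (x , y , z) = cong (λ c → value y , c , value z) (value-mirror x)

    -- Excludes a variable whose value lies in an outer or the middle layer.
    Good : Sym → Set
    Good c = KindOf (kind c) (value c)

    GoodPos : SymPos → Set
    GoodPos (x , y , z) = Good x × Good y × Good z

    good-coord : ∀ a p → GoodPos p → Good (symCoord a p)
    good-coord X p (x , y , z) = x
    good-coord Y p (x , y , z) = y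
    good-coord Z p (x , y , z) = z

    good-mirror : ∀ c → Good c → Good (mirror c)
    good-mirror c good = subst₂ KindOf (sym (kind-mirror c)) (sym (value-mirror c))
                                (opposite-kind (kind c) {value c} good)

    good-turnIf : ∀ b a q → GoodPos (proj₁ q) → GoodPos (proj₁ (turnIf b a q))
    good-turnIf false a q good = good
    good-turnIf true X ((x , y , z) , d) (gx , gy , gz) = (gx , gz , good-mirror y gy)
    good-turnIf true Y ((x , y , z) , d) (gx , gy , gz) = (good-mirror z gz , gy , gx)
    good-turnIf true Z ((x , y , z) , d) (gx , gy , gz) = (gy , good-mirror x gx , gz)

  -- Words in the generators that realise symbolic moves

  turn : Bool → Axis → Point n → Point n
  turn true  a (p , d) = (rotPos a p , rotDir a d)
  turn false a q       = q

  coord-rotPos : ∀ a (p : Pos n) → coord a (rotPos a p) ≡ coord a p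
  coord-rotPos X p = refl
  coord-rotPos Y p = refl
  coord-rotPos Z p = refl

  coord-turn : ∀ b a q → coord a (proj₁ (turn b a q)) ≡ coord a (proj₁ q)
  coord-turn true  a (p , d) = coord-rotPos a p
  coord-turn false a q       = refl

  move-yes : ∀ (g : Gen n) q → toℕ (coord (axis g) (proj₁ q)) ≡ toℕ (layer g) → move g q ≡ turn true (axis g) q
  move-yes (gen a c _) (p , d) eq with toℕ (coord a p) ≟ toℕ c
  ... | yes _ = refl
  ... | no ne = ⊥-elim (ne eq)

  move-no : ∀ (g : Gen n) q → toℕ (coord (axis g) (proj₁ q)) ≢ toℕ (layer g) → move g q ≡ q
  move-no (gen a c _) (p , d) ne with toℕ (coord a p) ≟ toℕ c
  ... | yes eq = ⊥-elim (ne eq)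
  ... | no _   = refl

  act-++ : ∀ (v w : List (Gen n)) q → act (v ++ w) q ≡ act w (act v q)
  act-++ []      w q = refl
  act-++ (g ∷ v) w q = act-++ v w (move g q)

  -- The failed test for the middle layer supplies the proof that `gen` requires. The middle layer
  -- itself gets the empty word, in agreement with `inLayer-mid`.
  layerWord : Axis → Layer → Fin n → List (Gen n)
  layerWord a L c with 2 * toℕ c + 1 ≟ n
  ... | yes _ = []
  ... | no ¬mid = if inLayer L (proj₁ (kindOf c)) then gen a c ¬mid ∷ [] else []

  inLayer-mid : ∀ L → inLayer L mid ≡ false
  inLayer-mid (outer _) = refl
  inLayer-mid inner     = refl
  inLayer-mid nonMid    = refl

  act-layerWord-≢ : ∀ a L c q → coord a (proj₁ q) ≢ c → act (layerWord a L c) q ≡ q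
  act-layerWord-≢ a L c q ne with 2 * toℕ c + 1 ≟ n
  ... | yes _ = refl
  ... | no ¬mid with inLayer L (proj₁ (kindOf c))
  ...   | false = refl
  ...   | true  = move-no (gen a c ¬mid) q (ne ∘ toℕ-injective)

  act-layerWord-≡ : ∀ a L q K → KindOf K (coord a (proj₁ q)) →
    act (layerWord a L (coord a (proj₁ q))) q ≡ turn (inLayer L K) a q
  act-layerWord-≡ a L q K isK with 2 * toℕ (coord a (proj₁ q)) + 1 ≟ n
  ... | yes isMid rewrite kind-unique K mid isK (middle⇒m isMid) | inLayer-mid L = refl
  ... | no ¬mid rewrite kind-unique (proj₁ (kindOf (coord a (proj₁ q)))) K (proj₂ (kindOf (coord a (proj₁ q)))) isK
    with inLayer L K
  ...   | false = refl
  ...   | true  = move-yes (gen a (coord a (proj₁ q)) ¬mid) q refl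

  act-layers-∉ : ∀ a L cs q → All (coord a (proj₁ q) ≢_) cs → act (concatMap (layerWord a L) cs) q ≡ q
  act-layers-∉ a L []       q []         = refl
  act-layers-∉ a L (c ∷ cs) q (ne ∷ nes) = begin
    act (layerWord a L c ++ concatMap (layerWord a L) cs) q
      ≡⟨ act-++ (layerWord a L c) _ q ⟩
    act (concatMap (layerWord a L) cs) (act (layerWord a L c) q)
      ≡⟨ cong (act (concatMap (layerWord a L) cs)) (act-layerWord-≢ a L c q ne) ⟩
    act (concatMap (layerWord a L) cs) q
      ≡⟨ act-layers-∉ a L cs q nes ⟩
    q ∎
    where open ≡-Reasoning

  -- A turn about `a` preserves the coordinate along `a`, so only the word of the point's own layer
  -- can move it, and `Unique` rules out meeting that word twice.
  act-layers-∈ : ∀ a L cs q K → Unique cs → coord a (proj₁ q) ∈ cs → KindOf K (coord a (proj₁ q)) →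
    act (concatMap (layerWord a L) cs) q ≡ turn (inLayer L K) a q
  act-layers-∈ a L (c ∷ cs) q K (c∉cs ∷ _) (here refl) isK = begin
    act (layerWord a L c ++ concatMap (layerWord a L) cs) q
      ≡⟨ act-++ (layerWord a L c) _ q ⟩
    act (concatMap (layerWord a L) cs) (act (layerWord a L c) q)
      ≡⟨ cong (act (concatMap (layerWord a L) cs)) (act-layerWord-≡ a L q K isK) ⟩
    act (concatMap (layerWord a L) cs) (turn (inLayer L K) a q)
      ≡⟨ act-layers-∉ a L cs _ (subst (λ x → All (x ≢_) cs) (sym (coord-turn (inLayer L K) a q)) c∉cs) ⟩
    turn (inLayer L K) a q ∎
    where open ≡-Reasoning
  act-layers-∈ a L (c ∷ cs) q K (c∉cs ∷ unique) (there x∈cs) isK = begin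
    act (layerWord a L c ++ concatMap (layerWord a L) cs) q
      ≡⟨ act-++ (layerWord a L c) _ q ⟩
    act (concatMap (layerWord a L) cs) (act (layerWord a L c) q)
      ≡⟨ cong (act (concatMap (layerWord a L) cs)) (act-layerWord-≢ a L c q (All.lookup c∉cs x∈cs ∘ sym)) ⟩
    act (concatMap (layerWord a L) cs) q
      ≡⟨ act-layers-∈ a L cs q K unique x∈cs isK ⟩
    turn (inLayer L K) a q ∎
    where open ≡-Reasoning

  realise : SymMove → List (Gen n)
  realise (a , L) = concatMap (layerWord a L) (allFin n)

  module _ (v : Axis → Fin n) where
    open Valuation v

    eval-turnIf : ∀ b a q → eval (turnIf b a q) ≡ turn b a (eval q)
    eval-turnIf true  a (p , d) = cong (_, rotDir a d) (evalPos-rot a p)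
    eval-turnIf false a q       = refl

    act-realise : ∀ g q → GoodPos (proj₁ q) → act (realise g) (eval q) ≡ eval (symMove g q)
    act-realise (a , L) q good = trans
      (act-layers-∈ a L (allFin n) (eval q) K (allFin⁺ n) (∈-allFin _)
        (subst (KindOf K) (sym (coord-evalPos a (proj₁ q))) (good-coord a (proj₁ q) good)))
      (sym (eval-turnIf (inLayer L K) a q))
      where
      K : Kind
      K = kind (symCoord a (proj₁ q))

    -- A symbolic move decides membership in a layer by the kinds of the symbols. `GoodPos`, carried
    -- along the word, guarantees that these are the kinds of the actual coordinates.
    act-realises : ∀ w q → GoodPos (proj₁ q) → act (concatMap realise w) (eval q) ≡ eval (symAct w q)
    act-realises []            q good = refl
    act-realises (g@(a , L) ∷ w) q good = begin
      act (realise g ++ concatMap realise w) (eval q)       ≡⟨ act-++ (realise g) _ (eval q) ⟩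
      act (concatMap realise w) (act (realise g) (eval q))  ≡⟨ cong (act (concatMap realise w)) (act-realise g q good) ⟩
      act (concatMap realise w) (eval (symMove g q))        ≡⟨ act-realises w (symMove g q) (good-turnIf (inLayer L (kind (symCoord a (proj₁ q)))) a q good) ⟩
      eval (symAct w (symMove g q))                         ∎
      where open ≡-Reasoning

  -- The single edges inside the cube

  open Valuation (λ _ → zero)

  -- Edge stickers contain no variable, so the constant valuation `zero` opened here is an arbitrary
  -- choice.
  point : Sticker → Point n
  point s = eval (stickerPoint s)

  good-edgePos : ∀ e → GoodPos (edgePos e)
  good-edgePos (X , s , t) = middle-kind , extreme-kind s , extreme-kind t
  good-edgePos (Y , s , t) = extreme-kind t , middle-kind , extreme-kind s
  good-edgePos (Z , s , t) = extreme-kind s , extreme-kind t , middle-kind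

  point-isFacelet : ∀ s → IsFacelet (point s)
  point-isFacelet ((X , s , t) , false) = extreme-kind s
  point-isFacelet ((X , s , t) , true)  = extreme-kind t
  point-isFacelet ((Y , s , t) , false) = extreme-kind s
  point-isFacelet ((Y , s , t) , true)  = extreme-kind t
  point-isFacelet ((Z , s , t) , false) = extreme-kind s
  point-isFacelet ((Z , s , t) , true)  = extreme-kind t

  kinds : Pos n → Kinds
  kinds (x , y , z) = (proj₁ (kindOf x) , proj₁ (kindOf y) , proj₁ (kindOf z))

  kindOf-value : ∀ c → Good c → proj₁ (kindOf (value c)) ≡ kind c
  kindOf-value c good = kind-unique _ (kind c) (proj₂ (kindOf (value c))) good

  -- Only meaningful on the kinds of an edge.
  edgeOf : Kinds → Edge
  edgeOf (mid , ext s , ext t) = (X , s , t)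
  edgeOf (ext t , mid , ext s) = (Y , s , t)
  edgeOf (ext s , ext t , mid) = (Z , s , t)
  edgeOf _                     = lastEdge

  edgeOf-edgePos : ∀ e → edgeOf (kinds (evalPos (edgePos e))) ≡ e
  edgeOf-edgePos (X , s , t)
    rewrite kindOf-value mid middle-kind | kindOf-value (ext s) (extreme-kind s) | kindOf-value (ext t) (extreme-kind t) = refl
  edgeOf-edgePos (Y , s , t)
    rewrite kindOf-value mid middle-kind | kindOf-value (ext s) (extreme-kind s) | kindOf-value (ext t) (extreme-kind t) = refl
  edgeOf-edgePos (Z , s , t)
    rewrite kindOf-value mid middle-kind | kindOf-value (ext s) (extreme-kind s) | kindOf-value (ext t) (extreme-kind t) = refl

  edgePos-injective : ∀ {e e′} → evalPos (edgePos e) ≡ evalPos (edgePos e′) → e ≡ e′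
  edgePos-injective {e} {e′} eq =
    trans (sym (edgeOf-edgePos e)) (trans (cong (edgeOf ∘ kinds) eq) (edgeOf-edgePos e′))

  next≢prev : ∀ a → next a ≢ prev a
  next≢prev X ()
  next≢prev Y ()
  next≢prev Z ()

  stickerDir-injective : ∀ e {b b′} → stickerDir (e , b) ≡ stickerDir (e , b′) → b ≡ b′
  stickerDir-injective e {false} {false} eq = refl
  stickerDir-injective e {false} {true}  eq = ⊥-elim (next≢prev (proj₁ e) (cong proj₁ eq))
  stickerDir-injective e {true}  {false} eq = ⊥-elim (next≢prev (proj₁ e) (cong proj₁ (sym eq)))
  stickerDir-injective e {true}  {true}  eq = refl

  -- The position recovers the edge and the normal recovers the number. Equalities between moved
  -- facelets can thus be read back as equalities between stickers.
  point-injective : ∀ {s s′} → point s ≡ point s′ → s ≡ s′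
  point-injective {e , b} {e′ , b′} eq with refl ← edgePos-injective {e} {e′} (cong proj₁ eq) =
    cong (e ,_) (stickerDir-injective e (cong proj₂ eq))

  -- Generators acting on edge stickers

  layerOf : Kind → Layer
  layerOf (ext s) = outer s
  layerOf _       = inner

  -- All inner layers become the same symbolic move. For single edges nothing is lost, since no
  -- inner turn moves them.
  genMove : Gen n → SymMove
  genMove g = (axis g , layerOf (proj₁ (kindOf (layer g))))

  edgePos-special : ∀ a e → kind (symCoord a (edgePos e)) ≢ other
  edgePos-special X (X , _) ()
  edgePos-special X (Y , _) ()
  edgePos-special X (Z , _) ()
  edgePos-special Y (X , _) ()
  edgePos-special Y (Y , _) ()
  edgePos-special Y (Z , _) ()
  edgePos-special Z (X , _) ()
  edgePos-special Z (Y , _) ()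
  edgePos-special Z (Z , _) ()

  inLayer-true : ∀ K K′ → K′ ≢ other → inLayer (layerOf K) K′ ≡ true → K′ ≡ K
  inLayer-true (ext false) (ext false) _ _ = refl
  inLayer-true (ext true)  (ext true)  _ _ = refl
  inLayer-true _           other      ne _ = ⊥-elim (ne refl)

  inLayer-self : ∀ K → K ≢ mid → inLayer (layerOf K) K ≡ true
  inLayer-self (ext false) _ = refl
  inLayer-self (ext true)  _ = refl
  inLayer-self mid        ne = ⊥-elim (ne refl)
  inLayer-self other       _ = refl

  -- Every coordinate of an edge sticker is outer or middle, hence determined by its kind. Lying in
  -- the layer of `g` therefore amounts to having the kind of that layer.
  move-sticker : ∀ g s → move g (point s) ≡ point (turnSticker (genMove g) s)
  move-sticker g@(gen a c ¬mid) s@(e@(m′ , u , t) , b) =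
    trans (turned (inLayer (layerOf K) K′) refl)
          (trans (sym (eval-turnIf (λ _ → zero) (inLayer (layerOf K) K′) a (stickerPoint s)))
                 (cong eval (symMove-sticker a (layerOf K) m′ u t b)))
    where
    K K′ : Kind
    K  = proj₁ (kindOf c)
    K′ = kind (symCoord a (edgePos e))

    isK′ : KindOf K′ (coord a (proj₁ (point s)))
    isK′ = subst (KindOf K′) (sym (coord-evalPos a (edgePos e))) (good-coord a (edgePos e) (good-edgePos e))

    K≢mid : K ≢ mid
    K≢mid eq = ¬mid (m⇒middle (subst (λ K → KindOf K c) eq (proj₂ (kindOf c))))

    turned : ∀ r → inLayer (layerOf K) K′ ≡ r → move g (point s) ≡ turn r a (point s)
    turned true eq = move-yes g (point s) (kind-injective K′ (edgePos-special a e) isK′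
      (subst (λ K → KindOf K c) (sym (inLayer-true K K′ (edgePos-special a e) eq)) (proj₂ (kindOf c))))
    -- Lying in the layer would force equal kinds; as the layer is not the middle one,
    -- `inLayer-self` then contradicts `eq`.
    turned false eq = move-no g (point s) λ same → false≢true (trans (sym eq) (trans
      (cong (inLayer (layerOf K)) (kind-unique K′ K isK′
        (subst (KindOf K) (sym (toℕ-injective same)) (proj₂ (kindOf c)))))
      (inLayer-self K K≢mid)))
      where
      false≢true : false ≢ true
      false≢true ()

  symbolic : List (Gen n) → List SymMove
  symbolic = map genMove

  act-sticker : ∀ w s → act w (point s) ≡ point (turnStickers (symbolic w) s)
  act-sticker []      s = refl
  act-sticker (g ∷ w) s = trans (cong (act w) (move-sticker g s)) (act-sticker w (turnSticker (genMove g) s))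

  -- Symbolic form of an arbitrary position

  symbol-value : ∀ (v : Axis → Fin n) a K → KindOf K (v a) → Valuation.value v (symbol a K) ≡ v a
  symbol-value v a (ext s) isK = toℕ-injective (kind-injective (ext s) (λ ()) (extreme-kind s) isK)
  symbol-value v a mid     isK = toℕ-injective (kind-injective mid (λ ()) middle-kind isK)
  symbol-value v a other   isK = refl

  symbol-kind : ∀ a K → kind (symbol a K) ≡ K
  symbol-kind a (ext s) = refl
  symbol-kind a mid     = refl
  symbol-kind a other   = refl

  symbol-good : ∀ (v : Axis → Fin n) a K → KindOf K (v a) → Valuation.Good v (symbol a K)
  symbol-good v a K isK = subst₂ KindOf (sym (symbol-kind a K)) (sym (symbol-value v a K isK)) isK

  -- The coordinates of `p` serve as the values of the unknowns, which makes the symbolic check on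
  -- `flipWord` applicable to any concrete facelet.
  evalPos-symbols : ∀ p → Valuation.evalPos (λ a → coord a p) (symbols (kinds p)) ≡ p
  evalPos-symbols p@(x , y , z) = cong₂ _,_ (eq X) (cong₂ _,_ (eq Y) (eq Z))
    where
    eq : ∀ a → Valuation.value (λ a → coord a p) (symbol a (proj₁ (kindOf (coord a p)))) ≡ coord a p
    eq a = symbol-value (λ a → coord a p) a (proj₁ (kindOf (coord a p))) (proj₂ (kindOf (coord a p)))

  good-symbols : ∀ p → Valuation.GoodPos (λ a → coord a p) (symbols (kinds p))
  good-symbols p = good X , good Y , good Z
    where
    good : ∀ a → Valuation.Good (λ a → coord a p) (symbol a (proj₁ (kindOf (coord a p))))
    good a = symbol-good (λ a → coord a p) a (proj₁ (kindOf (coord a p))) (proj₂ (kindOf (coord a p)))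

  -- Facelets on and off the single edges

  extreme-unique : ∀ {s x} → KindOf (ext s) x → x ≡ extreme s
  extreme-unique {s} isK = toℕ-injective (kind-injective (ext s) (λ ()) isK (extreme-kind s))

  middle-unique : ∀ {x} → KindOf mid x → x ≡ middle
  middle-unique isK = toℕ-injective (kind-injective mid (λ ()) isK middle-kind)

  -- The normal of such a facelet lies along one of the two outer coordinates, which selects the
  -- sticker number. A normal parallel to the edge would make the middle coordinate extreme.
  edge-facelet : ∀ {x y z} K₁ K₂ K₃ d → KindOf K₁ x → KindOf K₂ y → KindOf K₃ z →
    IsFacelet ((x , y , z) , d) → isEdge (K₁ , K₂ , K₃) ≡ true → ∃ λ s → ((x , y , z) , d) ≡ point s
  edge-facelet (ext s) (ext t) mid d k₁ k₂ k₃ f _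
    with refl ← extreme-unique {s} k₁ | refl ← extreme-unique {t} k₂ | refl ← middle-unique k₃ with d
  ... | X , u with refl ← kind-unique (ext u) (ext s) f k₁ = ((Z , s , t) , false) , refl
  ... | Y , u with refl ← kind-unique (ext u) (ext t) f k₂ = ((Z , s , t) , true) , refl
  ... | Z , u with () ← kind-unique (ext u) mid f k₃
  edge-facelet (ext s) mid (ext t) d k₁ k₂ k₃ f _
    with refl ← extreme-unique {s} k₁ | refl ← middle-unique k₂ | refl ← extreme-unique {t} k₃ with d
  ... | X , u with refl ← kind-unique (ext u) (ext s) f k₁ = ((Y , t , s) , true) , refl
  ... | Y , u with () ← kind-unique (ext u) mid f k₂
  ... | Z , u with refl ← kind-unique (ext u) (ext t) f k₃ = ((Y , t , s) , false) , refl
  edge-facelet mid (ext s) (ext t) d k₁ k₂ k₃ f _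
    with refl ← middle-unique k₁ | refl ← extreme-unique {s} k₂ | refl ← extreme-unique {t} k₃ with d
  ... | X , u with () ← kind-unique (ext u) mid f k₁
  ... | Y , u with refl ← kind-unique (ext u) (ext s) f k₂ = ((X , s , t) , false) , refl
  ... | Z , u with refl ← kind-unique (ext u) (ext t) f k₃ = ((X , s , t) , true) , refl

  data FaceletView : Point n → Set where
    onEdge  : ∀ s → FaceletView (point s)
    offEdge : ∀ p d → isEdge (kinds p) ≡ false → FaceletView (p , d)

  faceletView : ∀ q → IsFacelet q → FaceletView q
  faceletView (p@(x , y , z) , d) f with isEdge (kinds p) in eq
  ... | false = offEdge p d eq
  ... | true with edge-facelet _ _ _ d (proj₂ (kindOf x)) (proj₂ (kindOf y)) (proj₂ (kindOf z)) f eq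
  ...   | s , refl = onEdge s

  extreme-isExtreme : ∀ s → IsExtreme n (toℕ (extreme s))
  extreme-isExtreme false = inj₁ refl
  extreme-isExtreme true  = inj₂ (extreme-kind true)

  point-isSingleEdge : ∀ s → IsSingleEdge (proj₁ (point s))
  point-isSingleEdge ((X , s , t) , _) = inj₂ (inj₂ (m⇒middle middle-kind , extreme-isExtreme s , extreme-isExtreme t))
  point-isSingleEdge ((Y , s , t) , _) = inj₂ (inj₁ (extreme-isExtreme t , m⇒middle middle-kind , extreme-isExtreme s))
  point-isSingleEdge ((Z , s , t) , _) = inj₁ (extreme-isExtreme s , extreme-isExtreme t , m⇒middle middle-kind)

  isExtreme⇒kind : ∀ x → IsExtreme n (toℕ x) → ∃ λ s → proj₁ (kindOf x) ≡ ext s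
  isExtreme⇒kind x (inj₁ p) = false , kind-unique _ (ext false) (proj₂ (kindOf x)) p
  isExtreme⇒kind x (inj₂ p) = true , kind-unique _ (ext true) (proj₂ (kindOf x)) p

  isMiddle⇒kind : ∀ x → IsMiddle n (toℕ x) → proj₁ (kindOf x) ≡ mid
  isMiddle⇒kind x p = kind-unique _ mid (proj₂ (kindOf x)) (middle⇒m p)

  isSingleEdge⇒isEdge : ∀ p → IsSingleEdge p → isEdge (kinds p) ≡ true
  isSingleEdge⇒isEdge (x , y , z) (inj₁ (ex , ey , mz))
    rewrite proj₂ (isExtreme⇒kind x ex) | proj₂ (isExtreme⇒kind y ey) | isMiddle⇒kind z mz = refl
  isSingleEdge⇒isEdge (x , y , z) (inj₂ (inj₁ (ex , my , ez)))
    rewrite proj₂ (isExtreme⇒kind x ex) | isMiddle⇒kind y my | proj₂ (isExtreme⇒kind z ez) = refl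
  isSingleEdge⇒isEdge (x , y , z) (inj₂ (inj₂ (mx , ey , ez)))
    rewrite isMiddle⇒kind x mx | proj₂ (isExtreme⇒kind y ey) | proj₂ (isExtreme⇒kind z ez) = refl

  notEdge⇒notSingleEdge : ∀ p → isEdge (kinds p) ≡ false → ¬ IsSingleEdge p
  notEdge⇒notSingleEdge p eq single with () ← trans (sym eq) (isSingleEdge⇒isEdge p single)

  -- Membership in the subgroup of single edge flips

  FixesEdges FixesRest : List (Gen n) → Set
  FixesEdges w = ∀ e → proj₁ (turnStickers (symbolic w) (e , false)) ≡ e
  FixesRest  w = ∀ p d → IsFacelet (p , d) → isEdge (kinds p) ≡ false → act w (p , d) ≡ (p , d)

  flipped : List (Gen n) → Edge → Bool
  flipped w = flips (symbolic w)

  turnStickers-fixed : ∀ w → FixesEdges w → ∀ e b → turnStickers (symbolic w) (e , b) ≡ (e , b xor flipped w e)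
  turnStickers-fixed w fixes e b =
    trans (turnStickers-xor (symbolic w) e b) (cong (_, b xor flipped w e) (fixes e))

  -- `FixesEdges` watches one sticker of each edge; by `turnStickers-fixed` the other stays on that
  -- edge too, which yields the condition on positions.
  inOE : ∀ w → FixesEdges w → FixesRest w → InOE w
  inOE w fixE fixR = (λ (q , f) → positions q f (faceletView q f)) , (λ (q , f) → rest q f (faceletView q f))
    where
    positions : ∀ q → IsFacelet q → FaceletView q → proj₁ (act w q) ≡ proj₁ q
    positions _ _ (onEdge (e , b)) =
      cong proj₁ (trans (act-sticker w (e , b)) (cong point (turnStickers-fixed w fixE e b)))
    positions _ f (offEdge p d eq) = cong proj₁ (fixR p d f eq)

    rest : ∀ q → IsFacelet q → FaceletView q → ¬ IsSingleEdge (proj₁ q) → act w q ≡ q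
    rest _ _ (onEdge s)       ¬single = ⊥-elim (¬single (point-isSingleEdge s))
    rest _ f (offEdge p d eq) _       = fixR p d f eq

  fixesEdges : ∀ w → InOE w → FixesEdges w
  fixesEdges w (positions , _) e = edgePos-injective
    (trans (sym (cong proj₁ (act-sticker w (e , false)))) (positions (point (e , false) , point-isFacelet (e , false))))

  fixesRest : ∀ w → InOE w → FixesRest w
  fixesRest w (_ , rest) p d f eq = rest ((p , d) , f) (notEdge⇒notSingleEdge p eq)

  symbolic-++ : ∀ v w s → turnStickers (symbolic (v ++ w)) s ≡ turnStickers (symbolic w) (turnStickers (symbolic v) s)
  symbolic-++ v w s rewrite map-++ genMove v w = turnStickers-++ (symbolic v) (symbolic w) s

  turnStickers-++-fixed : ∀ v w → FixesEdges v → FixesEdges w → ∀ e →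
    turnStickers (symbolic (v ++ w)) (e , false) ≡ (e , flipped v e xor flipped w e)
  turnStickers-++-fixed v w fixV fixW e = begin
    turnStickers (symbolic (v ++ w)) (e , false)                         ≡⟨ symbolic-++ v w (e , false) ⟩
    turnStickers (symbolic w) (turnStickers (symbolic v) (e , false))    ≡⟨ cong (turnStickers (symbolic w)) (turnStickers-fixed v fixV e false) ⟩
    turnStickers (symbolic w) (e , flipped v e)                          ≡⟨ turnStickers-fixed w fixW e (flipped v e) ⟩
    (e , flipped v e xor flipped w e)                                    ∎
    where open ≡-Reasoning

  inOE-++ : ∀ v w → InOE v → InOE w → InOE (v ++ w)
  inOE-++ v w inV inW = inOE (v ++ w)
    (λ e → cong proj₁ (turnStickers-++-fixed v w (fixesEdges v inV) (fixesEdges w inW) e))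
    (λ p d f eq → trans (act-++ v w (p , d))
      (trans (cong (act w) (fixesRest v inV p d f eq)) (fixesRest w inW p d f eq)))

  turnStickers-≈G : ∀ v w → v ≈G w → ∀ s → turnStickers (symbolic v) s ≡ turnStickers (symbolic w) s
  turnStickers-≈G v w v≈w s = point-injective
    (trans (sym (act-sticker v s)) (trans (v≈w (point s , point-isFacelet s)) (act-sticker w s)))

  -- Realising a symbolic word and translating back gives in general a different, longer word. The
  -- two are compared through their common effect on actual facelets.
  turnStickers-realise : ∀ w s → turnStickers (symbolic (concatMap realise w)) s ≡ turnStickers w s
  turnStickers-realise w s = point-injective (begin
    point (turnStickers (symbolic (concatMap realise w)) s)  ≡⟨ act-sticker (concatMap realise w) s ⟨
    act (concatMap realise w) (point s)                      ≡⟨ act-realises _ w (stickerPoint s) (good-edgePos (proj₁ s)) ⟩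
    eval (symAct w (stickerPoint s))                         ≡⟨ cong eval (symAct-sticker w s) ⟩
    point (turnStickers w s)                                 ∎)
    where open ≡-Reasoning

  flipWordOE : Fin 11 → OE n
  flipWordOE i = word , inOE word
    (λ e@(m′ , s , t) → trans (cong proj₁ (turnStickers-realise (flipWord i) (e , false))) (turnStickers-flipWord i m′ s t))
    fixR
    where
    word : List (Gen n)
    word = concatMap realise (flipWord i)

    facelet-kind : ∀ p a s → IsFacelet (p , (a , s)) → kindAt a (kinds p) ≡ ext s
    facelet-kind (x , _ , _) X s f = kind-unique _ (ext s) (proj₂ (kindOf x)) f
    facelet-kind (_ , y , _) Y s f = kind-unique _ (ext s) (proj₂ (kindOf y)) f
    facelet-kind (_ , _ , z) Z s f = kind-unique _ (ext s) (proj₂ (kindOf z)) f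

    fixR : FixesRest word
    fixR p d@(a , s) f eq = begin
      act word (p , d)                                  ≡⟨ cong (λ p → act word (p , d)) (evalPos-symbols p) ⟨
      act word (evalₚ (symbols (kinds p) , d))          ≡⟨ act-realises _ (flipWord i) (symbols (kinds p) , d) (good-symbols p) ⟩
      evalₚ (symAct (flipWord i) (symbols (kinds p) , d)) ≡⟨ cong evalₚ (symAct-flipWord i _ _ _ a s (facelet-kind p a s f) eq) ⟩
      evalₚ (symbols (kinds p) , d)                     ≡⟨ cong (_, d) (evalPos-symbols p) ⟩
      (p , d)                                           ∎
      where
      open ≡-Reasoning
      evalₚ : SymPoint → Point n
      evalₚ = Valuation.eval (λ a → coord a p)

  -- The isomorphism given by eleven edge flips

  orientation : OE n → Z2^ 11
  orientation (w , _) = Vec.map (flipped w) edges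

  orientation-cong : (a b : OE n) → proj₁ a ≈G proj₁ b → orientation a ≡ orientation b
  orientation-cong (v , _) (w , _) v≈w =
    Vecₚ.map-cong (λ e → cong proj₂ (turnStickers-≈G v w v≈w (e , false))) edges

  orientation-homo : (a b c : OE n) → proj₁ c ≈G (proj₁ a ++ proj₁ b) → orientation c ≡ orientation a ⊕ orientation b
  orientation-homo (u , inU) (v , inV) (w , _) w≈u++v = Vecₚ.map-cong
    (λ e → cong proj₂ (trans (turnStickers-≈G w (u ++ v) w≈u++v (e , false))
                             (turnStickers-++-fixed u v (fixesEdges u inU) (fixesEdges v inV) e))) edges

  -- On the single edges eleven bits agree by hypothesis and the twelfth by parity; both words fix
  -- all other facelets.
  orientation-injective : (a b : OE n) → orientation a ≡ orientation b → proj₁ a ≈G proj₁ b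
  orientation-injective (v , inV) (w , inW) eq (q , f) = agree (faceletView q f) f
    where
    open ≡-Reasoning
    agree : ∀ {q} → FaceletView q → IsFacelet q → act v q ≡ act w q
    agree (onEdge (e , b)) _ = begin
      act v (point (e , b))                         ≡⟨ act-sticker v (e , b) ⟩
      point (turnStickers (symbolic v) (e , b))     ≡⟨ cong point (turnStickers-fixed v (fixesEdges v inV) e b) ⟩
      point (e , b xor flipped v e)                 ≡⟨ cong (λ c → point (e , b xor c)) (parity-determines (flipped v) (flipped w)
                                                        (trans (parity-flips (symbolic v)) (sym (parity-flips (symbolic w)))) eq e) ⟩
      point (e , b xor flipped w e)                 ≡⟨ cong point (turnStickers-fixed w (fixesEdges w inW) e b) ⟨
      point (turnStickers (symbolic w) (e , b))     ≡⟨ act-sticker w (e , b) ⟨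
      act w (point (e , b))                         ∎
    agree (offEdge p d eq′) f = trans (fixesRest v inV p d f eq′) (sym (fixesRest w inW p d f eq′))

  -- The image contains zero by the empty word and the units by `flipWordOE`, and concatenation
  -- closes it under `⊕`.
  orientation-surjective : (v : Z2^ 11) → ∃ λ a → orientation a ≡ v
  orientation-surjective = unit-induction (λ v → ∃ λ a → orientation a ≡ v)
    (([] , inOE [] (λ _ → refl) (λ _ _ _ _ → refl)) , refl)
    (λ i → flipWordOE i ,
      trans (Vecₚ.map-cong (λ e → cong proj₂ (turnStickers-realise (flipWord i) (e , false))) edges) (flips-flipWord i))
    (λ { _ _ (a@(u , inU) , refl) (b@(v , inV) , refl) →
      let c = u ++ v , inOE-++ u v inU inV in c , orientation-homo a b c (λ _ → refl) })

odd-≥3 : ∀ n → 3 ≤ n → n % 2 ≡ 1 → ∃ λ k → n ≡ suc (suc k * 2)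
odd-≥3 n 3≤n odd = halve (n / 2) (trans (m≡m%n+[m/n]*n n 2) (cong (_+ n / 2 * 2) odd))
  where
  halve : ∀ h → n ≡ suc (h * 2) → ∃ λ k → n ≡ suc (suc k * 2)
  -- Half equal to zero would give `n ≡ 1`, against `3 ≤ n`; this is why `m` may be taken to be a
  -- successor.
  halve zero    eq with s≤s () ← subst (3 ≤_) eq 3≤n
  halve (suc k) eq = k , eq

theorem16 : (n : ℕ) → 3 ≤ n → n % 2 ≡ 1 → Σ (OE n → Z2^ 11) (IsIsoOE n 11)
theorem16 n 3≤n odd with odd-≥3 n 3≤n odd
... | k , refl = orientation , orientation-cong , orientation-homo , orientation-injective , orientation-surjective
  where open Cube k
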